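{- Voxel representations of the complete graph $K_n$ require $\Omega(n^2)$ voxels. That is, there is an absolute constant $c>0$ such that for every integer $n\ge 1$, every voxel representation of $K_n$ has size at least $c\,n^2$.
   Context: A voxel is a cell of the unit cube grid in 3-dimensional space; two distinct voxels are adjacent if they share a face. A blob is a nonempty finite set of voxels that is connected with respect to this adjacency. A voxel representation of a finite simple graph $G=(V,E)$ assigns to each vertex $v\in V$ a blob $B_v$ such that the blobs of distinct vertices are disjoint and, for all distinct $u,v\in V$, some voxel of $B_u$ is adjacent to some voxel of $B_v$ if and only if $uv\in E$. Its size is $\sum_{v\in V}|B_v|$. -}

module Defs where

open import Data.Fin using (Fin)
open import Data.Integer as ℤ using (ℤ)
open import Data.List using (List; length; map; allFin)
open import Data.List.Membership.Propositional using (_∈_)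
open import Data.List.Relation.Binary.Disjoint.Propositional using (Disjoint)
open import Data.List.Relation.Unary.Unique.Propositional using (Unique)
open import Data.Nat using (ℕ)
open import Data.Nat.ListAction using (sum)
open import Data.Product using (∃-syntax; _×_; _,_)
open import Data.Sum using (_⊎_)
open import Data.Vec using (Vec; updateAt)
open import Function using (_⇔_)
open import Relation.Binary.Construct.Closure.ReflexiveTransitive using (Star)
open import Relation.Binary.PropositionalEquality
  using (_≡_; _≢_; ≢-sym)
open import Relation.Nullary using (¬_)

-- The cell [x,x+1] × [y,y+1] × [z,z+1], given by its least corner (x,y,z).
Voxel : Set
Voxel = Vec ℤ 3

-- A unit square of the grid: its normal axis and its least corner.
Face : Set
Face = Fin 3 × Vec ℤ 3

-- Along each axis i a voxel v has two faces: the lower one has the same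
-- least corner as v, the upper one has that corner moved by one along i.
_FaceOf_ : Face → Voxel → Set
(i , p) FaceOf v = p ≡ v ⊎ p ≡ updateAt v i ℤ.suc

Adjacent : Voxel → Voxel → Set
Adjacent u v = u ≢ v × ∃[ f ] (f FaceOf u × f FaceOf v)

AdjacentWithin : List Voxel → Voxel → Voxel → Set
AdjacentWithin S u v = u ∈ S × v ∈ S × Adjacent u v

-- The finite set of voxels is a duplicate-free list, so that its
-- cardinality is the length of the list.
record Blob : Set where
  field
    voxels    : List Voxel
    unique    : Unique voxels
    nonempty  : ∃[ v ] v ∈ voxels
    connected : ∀ {u v} → u ∈ voxels → v ∈ voxels →
                Star (AdjacentWithin voxels) u v

open Blob public using (voxels)

∣_∣ᵇ : Blob → ℕ
∣ B ∣ᵇ = length (voxels B)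

Touching : Blob → Blob → Set
Touching B C = ∃[ x ] ∃[ y ] (x ∈ voxels B × y ∈ voxels C × Adjacent x y)

record SimpleGraph (n : ℕ) : Set₁ where
  field
    Edge        : Fin n → Fin n → Set
    symmetric   : ∀ {u v} → Edge u v → Edge v u
    irreflexive : ∀ {v} → ¬ Edge v v

open SimpleGraph public using (Edge)

K : ∀ n → SimpleGraph n
K n = record
  { Edge        = _≢_
  ; symmetric   = ≢-sym
  ; irreflexive = λ v≢v → v≢v _≡_.refl
  }

record VoxelRepresentation {n : ℕ} (G : SimpleGraph n) : Set where
  field
    blob     : Fin n → Blob
    disjoint : ∀ {u v} → u ≢ v → Disjoint (voxels (blob u)) (voxels (blob v))
    contact  : ∀ {u v} → u ≢ v → Touching (blob u) (blob v) ⇔ Edge G u v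

size : ∀ {n} {G : SimpleGraph n} → VoxelRepresentation G → ℕ
size {n} R = sum (map (λ v → ∣ blob v ∣ᵇ) (allFin n))
  where open VoxelRepresentation R

{-# OPTIONS --safe #-}

-- A blob touching all the others meets every blob in its closed
-- neighbourhood, which has at most 7 ∣ B ∣ voxels. Blobs being disjoint,
-- n ≤ 7 ∣ B ∣ for each of the n blobs B, so that n² ≤ 7 · size.
module Submission where

open import Defs
open import Data.Nat as ℕ using (ℕ)
open import Data.Integer using (+_)
open import Data.Rational using (0ℚ; _/_; _*_; _≤_; _<_)
open import Data.Product using (∃-syntax; _×_)

open import Data.Fin using (Fin)
import Data.Fin.Properties as Fin
open import Data.Integer as ℤ using (ℤ)
import Data.Integer.Properties as ℤ
open import Data.List using (List; []; _∷_; length; map; concatMap; allFin)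
open import Data.List.Membership.Propositional using (_∈_; lose)
open import Data.List.Membership.Propositional.Properties
  using (∈-allFin; ∈-concatMap⁺)
open import Data.List.Membership.Setoid.Properties using (index-injective)
open import Data.List.Properties using (length-++; length-tabulate)
open import Data.List.Relation.Unary.Any using (here; there; index)
open import Data.Nat.ListAction using (sum)
import Data.Nat.Properties as ℕ
open import Data.Rational using (toℚᵘ)
import Data.Rational.Properties as ℚ
open import Data.Rational.Unnormalised as ℚᵘ using (mkℚᵘ)
import Data.Rational.Unnormalised.Properties as ℚᵘ
open import Data.Product using (_,_; proj₁; proj₂)
open import Data.Sum using (inj₁; inj₂)
open import Data.Vec using (Vec; updateAt)
open import Data.Vec.Properties
  using (updateAt-id-local; updateAt-updateAt)
open import Function using (id; _∘_; Equivalence)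
open import Relation.Binary.PropositionalEquality
  using (_≡_; refl; sym; trans; cong; subst; setoid)
open import Relation.Nullary using (yes; no; contradiction)
open import Relation.Nullary.Decidable using (decidable-stable; from-yes)

updateAt-inverse : ∀ {a} {A : Set a} {n} (i : Fin n) {f g : A → A} →
  (∀ x → f (g x) ≡ x) → (xs : Vec A n) →
  updateAt (updateAt xs i g) i f ≡ xs
updateAt-inverse i fg≗id xs =
  trans (updateAt-updateAt i xs) (updateAt-id-local i xs (fg≗id _))

pred-updateAt-suc : ∀ {n} (i : Fin n) (v : Vec ℤ n) →
  updateAt (updateAt v i ℤ.suc) i ℤ.pred ≡ v
pred-updateAt-suc i = updateAt-inverse i ℤ.pred-suc

axisNeighbours : Voxel → Fin 3 → List Voxel
axisNeighbours x i = updateAt x i ℤ.suc ∷ updateAt x i ℤ.pred ∷ []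

-- The voxel itself is listed beside its six face neighbours so that a blob meets its own
-- neighbourhood too; the count below then reaches n instead of n - 1.
neighbourhood : Voxel → List Voxel
neighbourhood x = x ∷ concatMap (axisNeighbours x) (allFin 3)

-- The shared face fixes the axis `i`. If it is the upper face of one voxel and the lower face of
-- the other, they differ by one step along `i`; if it is on the same side of both, the voxels
-- coincide.
Adjacent⇒∈neighbourhood : ∀ {x y} → Adjacent x y → y ∈ neighbourhood x
Adjacent⇒∈neighbourhood {x} {y} (x≢y , (i , _) , p-of-x , p-of-y) =
  there (∈-concatMap⁺ (axisNeighbours x) (lose (∈-allFin i) (onAxis p-of-x p-of-y)))
  where
  onAxis : ∀ {p} → (i , p) FaceOf x → (i , p) FaceOf y → y ∈ axisNeighbours x i
  onAxis (inj₁ refl) (inj₁ refl) = contradiction refl x≢y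
  onAxis (inj₁ refl) (inj₂ refl) = there (here (sym (pred-updateAt-suc i y)))
  onAxis (inj₂ refl) (inj₁ refl) = here refl
  -- Moving the common upper corner back down along `i` recovers both `x` and `y`.
  onAxis (inj₂ refl) (inj₂ x⁺≡y⁺) = contradiction
    (trans (sym (pred-updateAt-suc i x))
      (trans (cong (λ v → updateAt v i ℤ.pred) x⁺≡y⁺) (pred-updateAt-suc i y)))
    x≢y

length-concatMap-const : ∀ {a b} {A : Set a} {B : Set b} {k} (f : A → List B) →
  (∀ x → length (f x) ≡ k) → ∀ xs → length (concatMap f xs) ≡ length xs ℕ.* k
length-concatMap-const f eq []       = refl
length-concatMap-const f eq (x ∷ xs)
  rewrite length-++ (f x) {concatMap f xs} | eq x
        | length-concatMap-const f eq xs = refl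

-- Pigeonhole on positions: a position in `xs` determines its entry, hence the index `i`.
-- Repetitions in `xs` do no harm, so overlapping neighbourhoods can simply be concatenated.
injective∈⇒≤length : ∀ {a} {A : Set a} {n} {xs : List A} (f : Fin n → A) →
  (∀ {i j} → f i ≡ f j → i ≡ j) → (∀ i → f i ∈ xs) → n ℕ.≤ length xs
injective∈⇒≤length {A = A} f f-injective f∈xs = Fin.injective⇒≤
  {f = index ∘ f∈xs}
  (f-injective ∘ index-injective (setoid A) (f∈xs _) (f∈xs _))

*-≤-sum-map : ∀ {a} {A : Set a} {m k} (f : A → ℕ) →
  (∀ x → m ℕ.≤ f x ℕ.* k) → ∀ xs → length xs ℕ.* m ℕ.≤ sum (map f xs) ℕ.* k
*-≤-sum-map f m≤ []       = ℕ.z≤n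
*-≤-sum-map {k = k} f m≤ (x ∷ xs)
  rewrite ℕ.*-distribʳ-+ k (f x) (sum (map f xs)) =
  ℕ.+-mono-≤ (m≤ x) (*-≤-sum-map f m≤ xs)

module _ {n} (R : VoxelRepresentation (K n)) where
  open VoxelRepresentation R

  blobNeighbourhood : Fin n → List Voxel
  blobNeighbourhood u = concatMap neighbourhood (voxels (blob u))

  -- Completeness of the graph enters here: any two distinct blobs touch.
  meetsBlobNeighbourhood : ∀ u v →
    ∃[ y ] (y ∈ voxels (blob v) × y ∈ blobNeighbourhood u)
  meetsBlobNeighbourhood u v with u Fin.≟ v
  ... | yes refl =
    let x , x∈B = Blob.nonempty (blob u)
    in x , x∈B , ∈-concatMap⁺ neighbourhood (lose x∈B (here refl))
  ... | no u≢v =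
    let x , y , x∈B , y∈C , x~y = Equivalence.from (contact u≢v) u≢v
    in y , y∈C , ∈-concatMap⁺ neighbourhood (lose x∈B (Adjacent⇒∈neighbourhood x~y))

  ∈-blob-unique : ∀ {u v x} → x ∈ voxels (blob u) → x ∈ voxels (blob v) → u ≡ v
  ∈-blob-unique {u} {v} x∈B x∈C =
    decidable-stable (u Fin.≟ v) (λ u≢v → disjoint u≢v (x∈B , x∈C))

  order≤7∣blob∣ : ∀ u → n ℕ.≤ ∣ blob u ∣ᵇ ℕ.* 7
  order≤7∣blob∣ u = subst (n ℕ.≤_)
    -- `neighbourhood x` evaluates to an explicit list of 1 + 3 · 2 = 7 entries, so `refl` proves
    -- its length.
    (length-concatMap-const neighbourhood (λ _ → refl) (voxels (blob u)))
    -- One voxel is chosen from each blob; disjointness makes the choice injective.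
    (injective∈⇒≤length (proj₁ ∘ meetsBlobNeighbourhood u)
      (λ {v} {w} eq → ∈-blob-unique
        (proj₁ (proj₂ (meetsBlobNeighbourhood u v)))
        (subst (_∈ voxels (blob w)) (sym eq)
          (proj₁ (proj₂ (meetsBlobNeighbourhood u w)))))
      (proj₂ ∘ proj₂ ∘ meetsBlobNeighbourhood u))

  order²≤7size : n ℕ.^ 2 ℕ.≤ size R ℕ.* 7
  order²≤7size = begin
    n ℕ.^ 2                       ≡⟨ cong (n ℕ.*_) (ℕ.*-identityʳ n) ⟩
    n ℕ.* n                       ≡⟨ cong (ℕ._* n) (length-tabulate {n = n} id) ⟨
    length (allFin n) ℕ.* n       ≤⟨ *-≤-sum-map _ order≤7∣blob∣ (allFin n) ⟩
    size R ℕ.* 7                  ∎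
    where open ℕ.≤-Reasoning

-- Since `_/_` reduces to lowest terms, the comparison is moved to unnormalised fractions, where the
-- order is cross-multiplication of the given numerators and denominators.
≤*⇒1/*≤ : ∀ d .{{_ : ℕ.NonZero d}} m s → m ℕ.≤ s ℕ.* d →
  (+ 1 / d) * (+ m / 1) ≤ + s / 1
≤*⇒1/*≤ d@(ℕ.suc d-1) m s m≤sd = ℚ.toℚᵘ-cancel-≤ (begin
  toℚᵘ ((+ 1 / d) * (+ m / 1))
    ≃⟨ ℚ.toℚᵘ-homo-* (+ 1 / d) (+ m / 1) ⟩
  toℚᵘ (+ 1 / d) ℚᵘ.* toℚᵘ (+ m / 1)
    ≃⟨ ℚᵘ.*-cong (ℚ.toℚᵘ-fromℚᵘ (mkℚᵘ (+ 1) d-1)) (ℚ.toℚᵘ-fromℚᵘ (mkℚᵘ (+ m) 0)) ⟩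
  mkℚᵘ (+ 1) d-1 ℚᵘ.* mkℚᵘ (+ m) 0
    ≤⟨ ℚᵘ.*≤* cross ⟩
  mkℚᵘ (+ s) 0
    ≃⟨ ℚ.toℚᵘ-fromℚᵘ (mkℚᵘ (+ s) 0) ⟨
  toℚᵘ (+ s / 1) ∎)
  where
  open ℚᵘ.≤-Reasoning
  -- The comparison of (1 · m)/(d · 1) with s/1, multiplied out.
  cross : (+ 1 ℤ.* + m) ℤ.* + 1 ℤ.≤ + s ℤ.* + (d ℕ.* 1)
  cross rewrite ℤ.*-identityʳ (+ 1 ℤ.* + m) | ℤ.*-identityˡ (+ m)
              | ℕ.*-identityʳ d | sym (ℤ.pos-* s d) = ℤ.+≤+ m≤sd

mainTheorem6 : ∃[ c ] (0ℚ < c ×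
    (∀ (n : ℕ) → 1 ℕ.≤ n → (R : VoxelRepresentation (K n)) →
    c * (+ (n ℕ.^ 2) / 1) ≤ + size R / 1))
mainTheorem6 =
  + 1 / 7 , from-yes (0ℚ ℚ.<? + 1 / 7) ,
  λ n _ R → ≤*⇒1/*≤ 7 (n ℕ.^ 2) (size R) (order²≤7size R)
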